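{- Let $P$ be a program of continuation calculus that contains the following rules: $$\mathit{Zero}.z.s\to z,\qquad \mathit{S}.x.z.s\to s.x,\qquad \mathit{Nil}.e.c\to e,\qquad \mathit{Cons}.x.xs.e.c\to c.x.xs,$$ $$\mathit{ListMult}.xs.r\to A.xs.r.(r.\mathit{Zero}),$$ $$A.xs.r.abort\to xs.(r.(S.\mathit{Zero})).(B.r.abort),$$ $$B.r.abort.x.xs\to x.abort.(C.r.abort.x.xs),$$ $$C.r.abort.x.xs.x'\to A.xs.(\mathit{PostMult}.x.r).abort,$$ $$\mathit{PostMult}.x.r.y\to \mathit{Mult}.x.y.r,$$ $$\mathit{Mult}.x.y.r\to y.(r.\mathit{Zero}).(\mathit{PostMult}.x.(\mathit{PostAdd}.x.r)).$$ Assume that in $P$ the name $\mathit{Mult}$ satisfies its specification: for all natural numbers $m,p$, all terms $r$, all $t\in\langle\!\langle m\rangle\!\rangle$ and all $u\in\langle\!\langle p\rangle\!\rangle$, there is $v\in\langle\!\langle m\cdot p\rangle\!\rangle$ with $\mathit{Mult}.t.u.r\twoheadrightarrow_P r.v$. Then for every finite list $l$ of natural numbers, every term $r\in\mathcal U$ and every $t\in\langle\!\langle l\rangle\!\rangle$, there exists $u\in\langle\!\langle \mathrm{product}(l)\rangle\!\rangle$ such that $$\mathit{ListMult}.t.r\twoheadrightarrow_P r.u,$$ where $\mathrm{product}(l)$ is the product of the entries of $l$ (with $\mathrm{product}([])=1$).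
   Context: Continuation calculus (CC). Fix an infinite set $\mathcal N$ of names. The set $\mathcal U$ of terms is freely generated by $\mathcal U ::= \mathcal N \mid \mathcal U.\mathcal U$, where the dot is a binary constructor read left-associatively ($A.B.C=(A.B).C$); terms contain no variables. Every term is uniquely of the form $n.t_1.\cdots.t_k$ with $n$ a name (its head) and $k\ge 0$ (its length). Fix an infinite set $\mathcal V$ of variables, disjoint from terms. A rule is an expression $n.x_1.\cdots.x_k\to q$ with $k\ge 0$, $n$ a name, $x_1,\dots,x_k$ distinct variables, and $q$ built from names and the variables $x_1,\dots,x_k$ using the dot; this rule defines $n$. A program is a finite set of rules, no two of which define the same name. An extension of $P$ is a program $P'\supseteq P$. Evaluation: $n.t_1.\cdots.t_k\to_P q[\vec x:=\vec t]$ whenever the rule $n.x_1.\cdots.x_k\to q$ is in $P$ (same $k$); no other term has a successor. So $\to_P$ is a partial function; $\twoheadrightarrow_P$ is its reflexive transitive closure. A term is final ($M\downarrow_P$) if it has no successor, and $M$ is terminating under $P$ if $M\twoheadrightarrow_P N$ for some final $N$. Observational equivalence: $M\approx_P N$ iff for all extensions $P'\supseteq P$ and all terms $X$, $X.M$ is terminating under $P'$ iff $X.N$ is terminating under $P'$. In the rules listed in the claim, capitalized words/letters ($\mathit{Zero}$, $S$, $\mathit{Nil}$, $\mathit{Cons}$, $\mathit{ListMult}$, $A$, $B$, $C$, $\mathit{PostMult}$, $\mathit{Mult}$, $\mathit{PostAdd}$) are distinct names, and lower-case words/letters ($z,s,x,xs,x',y,e,c,r,abort$) are variables. Data. Standard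 representations: $\langle 0\rangle=\mathit{Zero}$, $\langle m+1\rangle=S.\langle m\rangle$, $\langle []\rangle=\mathit{Nil}$, $\langle m:l\rangle=\mathit{Cons}.\langle m\rangle.\langle l\rangle$. The sets $\llbracket\mathbb N\rrbracket$ and $\llbracket \mathsf{List}_{\mathbb N}\rrbracket$ (depending on $P$) are the smallest sets of terms satisfying $\llbracket\mathbb N\rrbracket=\{M\in\mathcal U \mid (\forall z,s\in\mathcal U:\ M.z.s\twoheadrightarrow_P z)\ \vee\ \exists x\in\llbracket\mathbb N\rrbracket\ \forall z,s\in\mathcal U:\ M.z.s\twoheadrightarrow_P s.x\}$ and $\llbracket\mathsf{List}_{\mathbb N}\rrbracket=\{M\in\mathcal U \mid (\forall e,c\in\mathcal U:\ M.e.c\twoheadrightarrow_P e)\ \vee\ \exists x\in\llbracket\mathbb N\rrbracket,\,xs\in\llbracket\mathsf{List}_{\mathbb N}\rrbracket\ \forall e,c\in\mathcal U:\ M.e.c\twoheadrightarrow_P c.x.xs\}$. For a natural number $k$, $\langle\!\langle k\rangle\!\rangle=\{M\in\llbracket\mathbb N\rrbracket\mid M\approx_P\langle k\rangle\}$; for a list $l$ of naturals, $\langle\!\langle l\rangle\!\rangle=\{M\in\llbracket\mathsf{List}_{\mathbb N}\rrbracket\mid M\approx_P\langle l\rangle\}$. -}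

module Defs where

open import Data.Fin using (Fin)
open import Data.List using (List; []; _∷_)
open import Data.List.Membership.Propositional using (_∈_; _∉_)
open import Data.List.Relation.Binary.Subset.Propositional using (_⊆_)
open import Data.List.Relation.Unary.Unique.Propositional using (Unique)
open import Data.Nat using (ℕ; zero; suc)
open import Data.Product using (∃; _×_)
open import Data.Vec using (Vec; lookup; foldl′; map; allFin)
open import Data.Vec.N-ary using (N-ary; _$ⁿ_)
open import Function using (_⇔_)
open import Level using (0ℓ)
open import Relation.Binary using (Rel)
open import Relation.Binary.Construct.Closure.ReflexiveTransitive using (Star)
open import Relation.Binary.PropositionalEquality using (_≡_)
open import Relation.Nullary using (¬_)
open import Relation.Unary using (Pred; _∩_)

-- "Not exhausted by any finite list", in the form that yields fresh elements
-- constructively.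
Infinite : Set → Set
Infinite A = (xs : List A) → ∃ λ x → x ∉ xs

infixl 7 _·_
infix 4 _⊢_⟶_ _⊢_↠_ _⊢_≈_

data Term (Name : Set) (k : ℕ) : Set where
  name : Name → Term Name k
  var  : Fin k → Term Name k
  _·_  : Term Name k → Term Name k → Term Name k

-- The terms of the calculus proper, which contain no variables.
𝒰 : Set → Set
𝒰 Name = Term Name 0

variable
  Name : Set

_·*_ : {k n : ℕ} → Term Name k → Vec (Term Name k) n → Term Name k
h ·* ts = foldl′ _·_ h ts

_[_] : {k : ℕ} → Term Name k → Vec (𝒰 Name) k → 𝒰 Name
name n  [ ts ] = name n
var i   [ ts ] = lookup ts i
(q · r) [ ts ] = (q [ ts ]) · (r [ ts ])

-- head.x₁.⋯.xₖ → body with k = arity, where xᵢ₊₁ is represented by var i; rules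
-- are thereby identified up to renaming of their variables.
record Rule (Name : Set) : Set where
  field
    head  : Name
    arity : ℕ
    body  : Term Name arity

open Rule

record Program (Name : Set) : Set where
  field
    rules      : List (Rule Name)
    functional : ∀ {ρ σ} → ρ ∈ rules → σ ∈ rules → head ρ ≡ head σ → ρ ≡ σ

open Program public using (rules)

data _⊢_⟶_ (P : Program Name) : Rel (𝒰 Name) 0ℓ where
  step : ∀ {ρ} → ρ ∈ rules P → (ts : Vec (𝒰 Name) (arity ρ)) →
         P ⊢ name (head ρ) ·* ts ⟶ body ρ [ ts ]

_⊢_↠_ : Program Name → Rel (𝒰 Name) 0ℓ
P ⊢ M ↠ N = Star (P ⊢_⟶_) M N

Final : Program Name → Pred (𝒰 Name) 0ℓ
Final P M = ¬ ∃ λ N → P ⊢ M ⟶ N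

Terminating : Program Name → Pred (𝒰 Name) 0ℓ
Terminating P M = ∃ λ N → P ⊢ M ↠ N × Final P N

_⊢_≈_ : Program Name → Rel (𝒰 Name) 0ℓ
_⊢_≈_ {Name} P M N =
  (P′ : Program Name) → rules P ⊆ rules P′ →
  (X : 𝒰 Name) → Terminating P′ (X · M) ⇔ Terminating P′ (X · N)

record Names (Name : Set) : Set where
  field
    Zero S Nil Cons ListMult A B C PostMult Mult PostAdd : Name
    distinct : Unique (Zero ∷ S ∷ Nil ∷ Cons ∷ ListMult ∷ A ∷ B ∷ C ∷
                       PostMult ∷ Mult ∷ PostAdd ∷ [])

-- rule f k (λ x₁ … xₖ → q) is the rule f.x₁.⋯.xₖ → q.
rule : Name → (k : ℕ) → N-ary k (Term Name k) (Term Name k) → Rule Name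
rule f k q = record { head = f ; arity = k ; body = q $ⁿ map var (allFin k) }

listMultRules : Names Name → List (Rule Name)
listMultRules c =
    rule Zero     2 (λ z s → z)
  ∷ rule S        3 (λ x z s → s · x)
  ∷ rule Nil      2 (λ e c → e)
  ∷ rule Cons     4 (λ x xs e c → c · x · xs)
  ∷ rule ListMult 2 (λ xs r → name A · xs · r · (r · name Zero))
  ∷ rule A        3 (λ xs r abort →
      xs · (r · (name S · name Zero)) · (name B · r · abort))
  ∷ rule B        4 (λ r abort x xs →
      x · abort · (name C · r · abort · x · xs))
  ∷ rule C        5 (λ r abort x xs x′ →
      name A · xs · (name PostMult · x · r) · abort)
  ∷ rule PostMult 3 (λ x r y → name Mult · x · y · r)
  ∷ rule Mult     3 (λ x y r →
      y · (r · name Zero)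
        · (name PostMult · x · (name PostAdd · x · r)))
  ∷ []
  where open Names c

open Names public using (Zero; S; Nil; Cons; ListMult; Mult)

⟨_⟩ℕ : ℕ → Names Name → 𝒰 Name
⟨ zero  ⟩ℕ c = name (Zero c)
⟨ suc m ⟩ℕ c = name (S c) · ⟨ m ⟩ℕ c

⟨_⟩List : List ℕ → Names Name → 𝒰 Name
⟨ []    ⟩List c = name (Nil c)
⟨ m ∷ l ⟩List c = name (Cons c) · ⟨ m ⟩ℕ c · ⟨ l ⟩List c

data ⟦ℕ⟧ (P : Program Name) : Pred (𝒰 Name) 0ℓ where
  zero-like : ∀ {M} → (∀ z s → P ⊢ M · z · s ↠ z) → ⟦ℕ⟧ P M
  suc-like  : ∀ {M x} → ⟦ℕ⟧ P x →
              (∀ z s → P ⊢ M · z · s ↠ s · x) → ⟦ℕ⟧ P M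

data ⟦List⟧ (P : Program Name) : Pred (𝒰 Name) 0ℓ where
  nil-like  : ∀ {M} → (∀ e c → P ⊢ M · e · c ↠ e) → ⟦List⟧ P M
  cons-like : ∀ {M x xs} → ⟦ℕ⟧ P x → ⟦List⟧ P xs →
              (∀ e c → P ⊢ M · e · c ↠ c · x · xs) → ⟦List⟧ P M

⟪_⟫ℕ : ℕ → Names Name → Program Name → Pred (𝒰 Name) 0ℓ
⟪ k ⟫ℕ c P = ⟦ℕ⟧ P ∩ (λ M → P ⊢ M ≈ ⟨ k ⟩ℕ c)

⟪_⟫List : List ℕ → Names Name → Program Name → Pred (𝒰 Name) 0ℓ
⟪ l ⟫List c P = ⟦List⟧ P ∩ (λ M → P ⊢ M ≈ ⟨ l ⟩List c)

{-# OPTIONS --safe #-}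

-- Observations may use rules with fresh names, which do not affect the other
-- terms, so observationally equivalent terms M and N are still equivalent in
-- the form M.e.c and N.e.c. Choosing e final and c divergent separates nil from
-- cons and zero from successor; choosing for c a continuation that selects a
-- component shows that equivalent cons cells have equivalent components. A list
-- equivalent to ⟨ l ⟩ thus unfolds in step with l, and by induction on l
-- A.xs.r.abort either yields the product to r or, when that product is 0,
-- jumps to abort.
module Submission where

open import Defs
open import Data.Fin using (Fin; zero; suc)
open import Data.List using (List; []; _∷_; _++_; concatMap)
open import Data.List.Membership.Propositional using (_∉_)
  renaming (_∈_ to _∈ₗ_)
open import Data.List.Membership.Propositional.Properties
  using (∈-++⁺ˡ; ∈-++⁺ʳ; ∈-concatMap⁺)
open import Data.List.Relation.Binary.Subset.Propositional using (_⊆_)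
open import Data.List.Relation.Unary.All as All using (All; []; _∷_)
open import Data.List.Relation.Unary.Any as Any using (here; there)
open import Data.Nat using (ℕ; zero; suc; _*_)
open import Data.Nat.ListAction using (product)
open import Data.Nat.Properties using (*-zeroʳ)
open import Data.Product using (∃; _×_; _,_; proj₁; proj₂)
open import Data.Sum using (_⊎_; inj₁; inj₂)
open import Data.Vec using (Vec; []; _∷_; lookup)
open import Function using (_⇔_; mk⇔; _∘_; Equivalence)
open import Function.Construct.Composition using (_⇔-∘_)
open import Function.Construct.Identity using (⇔-id)
open import Function.Construct.Symmetry using (⇔-sym)
open import Relation.Binary.Construct.Closure.ReflexiveTransitive
  using (ε; _◅_; _◅◅_; map)
open import Relation.Binary.PropositionalEquality
  using (_≡_; _≢_; refl; sym; trans; cong; cong₂; subst)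
open import Relation.Nullary using (¬_; contradiction)
open import Relation.Unary using (_∈_)

open Equivalence using (to; from)
open Program using (functional)
open Rule

-- Determinism of evaluation and its effect on termination.

headOf : 𝒰 Name → Name
headOf (name n) = n
headOf (q · r)  = headOf q

headOf-·* : ∀ {n} (h : 𝒰 Name) (ts : Vec (𝒰 Name) n) →
            headOf (h ·* ts) ≡ headOf h
headOf-·* h []       = refl
headOf-·* h (t ∷ ts) = headOf-·* (h · t) ts

·-injective : ∀ {k} {q r q′ r′ : Term Name k} →
              q · r ≡ q′ · r′ → q ≡ q′ × r ≡ r′
·-injective refl = refl , refl

·*-injective : ∀ {n k} {h h′ : Term Name k} (ts ts′ : Vec (Term Name k) n) →
               h ·* ts ≡ h′ ·* ts′ → h ≡ h′ × ts ≡ ts′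
·*-injective []       []         eq = eq , refl
·*-injective (t ∷ ts) (t′ ∷ ts′) eq
  with eq₁ , eq₂ ← ·*-injective ts ts′ eq
  with eq₃ , eq₄ ← ·-injective eq₁ = eq₃ , cong₂ _∷_ eq₄ eq₂

-- The index of `step` is computed by `_·*_`, which pattern matching cannot unify with a given term;
-- explicit equations take its place.
⟶-inv : ∀ {P : Program Name} {M N} → P ⊢ M ⟶ N →
        ∃ λ ρ → ∃ λ ts → ρ ∈ₗ rules P ×
          M ≡ name (head ρ) ·* ts × N ≡ body ρ [ ts ]
⟶-inv (step ρ∈ ts) = _ , ts , ρ∈ , refl , refl

-- Equal terms have equal heads, so `functional` forces a single rule; its arity fixes the number of
-- arguments, and `·*-injective` identifies them.
⟶-deterministic : ∀ {P : Program Name} {M N N′} →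
                  P ⊢ M ⟶ N → P ⊢ M ⟶ N′ → N ≡ N′
⟶-deterministic {P = P} s s′
  with ρ , ts , ρ∈ , eq , refl ← ⟶-inv s
  with σ , us , σ∈ , eq′ , refl ← ⟶-inv s′
  with refl ← functional P ρ∈ σ∈
         (trans (sym (headOf-·* _ ts))
         (trans (cong headOf (trans (sym eq) eq′)) (headOf-·* _ us)))
  with _ , refl ← ·*-injective ts us (trans (sym eq) eq′) = refl

-- By determinism a reduction of `M` to a final term passes through `N`, as no earlier term is
-- final.
↠-Terminating : ∀ {P : Program Name} {M N} → P ⊢ M ↠ N →
                Terminating P M ⇔ Terminating P N
↠-Terminating {P = P} red =
  mk⇔ (forward red) (λ (V , red′ , fin) → V , red ◅◅ red′ , fin)
  where
  forward : ∀ {M N} → P ⊢ M ↠ N → Terminating P M → Terminating P N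
  forward ε        term              = term
  forward (s ◅ ss) (V , ε , fin)     = contradiction (_ , s) fin
  forward (s ◅ ss) (V , s′ ◅ ss′ , fin)
    with refl ← ⟶-deterministic s s′ = forward ss (V , ss′ , fin)

loop-↠ : ∀ {P : Program Name} {M N} → P ⊢ M ⟶ M → P ⊢ M ↠ N → N ≡ M
loop-↠ s ε         = refl
loop-↠ s (s′ ◅ ss) with refl ← ⟶-deterministic s s′ = loop-↠ s ss

loop-diverges : ∀ {P : Program Name} {M} → P ⊢ M ⟶ M → ¬ Terminating P M
loop-diverges s (V , red , fin) with refl ← loop-↠ s red = fin (_ , s)

⟶-mono : ∀ {P P′ : Program Name} {M N} → rules P ⊆ rules P′ →
         P ⊢ M ⟶ N → P′ ⊢ M ⟶ N
⟶-mono P⊆P′ (step ρ∈ ts) = step (P⊆P′ ρ∈) ts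

↠-mono : ∀ {P P′ : Program Name} {M N} → rules P ⊆ rules P′ →
         P ⊢ M ↠ N → P′ ⊢ M ↠ N
↠-mono {P = P} {P′} P⊆P′ = map (⟶-mono {P = P} {P′} P⊆P′)

-- Fresh names and conservative extensions.

infix 4 _#_ _#ₚ_

data _#_ {k : ℕ} (f : Name) : Term Name k → Set where
  name : ∀ {n} → f ≢ n → f # name n
  var  : ∀ {i} → f # var i
  _·_  : ∀ {q r} → f # q → f # r → f # q · r

-- Bodies must avoid `f` too, lest a step introduce it into a term where it is fresh.
_#ₚ_ : Name → Program Name → Set
f #ₚ P = ∀ {ρ} → ρ ∈ₗ rules P → f ≢ head ρ × f # body ρ

names : ∀ {k} → Term Name k → List Name
names (name n) = n ∷ []
names (var i)  = []
names (q · r)  = names q ++ names r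

∉names⇒# : ∀ {k} {f : Name} (q : Term Name k) → f ∉ names q → f # q
∉names⇒# (name n) f∉ = name (f∉ ∘ here)
∉names⇒# (var i)  f∉ = var
∉names⇒# (q · r)  f∉ =
  ∉names⇒# q (f∉ ∘ ∈-++⁺ˡ) · ∉names⇒# r (f∉ ∘ ∈-++⁺ʳ (names q))

ruleNames : Rule Name → List Name
ruleNames ρ = head ρ ∷ names (body ρ)

fresh : Infinite Name → (P : Program Name) (Ts : List (𝒰 Name)) →
        ∃ λ f → f #ₚ P × All (f #_) Ts
fresh {Name} inf P Ts
  with f , f∉ ← inf (concatMap ruleNames (rules P) ++ concatMap names Ts) =
  f
  , (λ {ρ} ρ∈ →
      let f∉ρ = f∉ ∘ ∈-++⁺ˡ ∘ ∈-concatMap⁺ ruleNames ∘ occurs ρ∈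
      in f∉ρ ∘ here , ∉names⇒# (body ρ) (f∉ρ ∘ there))
  , All.tabulate (λ {T} T∈ → ∉names⇒# T
      (f∉ ∘ ∈-++⁺ʳ (concatMap ruleNames (rules P)) ∘ ∈-concatMap⁺ names
          ∘ occurs T∈))
  where
  occurs : ∀ {A : Set} {g : A → List Name} {x xs n} →
           x ∈ₗ xs → n ∈ₗ g x → Any.Any (λ y → n ∈ₗ g y) xs
  occurs x∈ n∈ = Any.map (λ { refl → n∈ }) x∈

#-·*⁻ : ∀ {n} {f : Name} {h : 𝒰 Name} (ts : Vec (𝒰 Name) n) →
        f # h ·* ts → f # h × (∀ i → f # lookup ts i)
#-·*⁻ []       f# = f# , λ ()
#-·*⁻ (t ∷ ts) f#
  with f#h · f#t , f#ts ← #-·*⁻ ts f# =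
  f#h , λ { zero → f#t ; (suc i) → f#ts i }

#-[] : ∀ {k} {f : Name} {q : Term Name k} {ts : Vec (𝒰 Name) k} →
       f # q → (∀ i → f # lookup ts i) → f # q [ ts ]
#-[] (name f≢n)  f#ts = name f≢n
#-[] (var {i})   f#ts = f#ts i
#-[] (f#q · f#r) f#ts = #-[] f#q f#ts · #-[] f#r f#ts

extend : (P : Program Name) (ρ : Rule Name) → head ρ #ₚ P → Program Name
extend P ρ ρ#P = record { rules = ρ ∷ rules P ; functional = functional′ }
  where
  functional′ : ∀ {σ τ} → σ ∈ₗ ρ ∷ rules P → τ ∈ₗ ρ ∷ rules P →
                head σ ≡ head τ → σ ≡ τ
  functional′ (here refl) (here refl) _  = refl
  functional′ (here refl) (there τ∈)  eq = contradiction eq (proj₁ (ρ#P τ∈))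
  functional′ (there σ∈)  (here refl) eq =
    contradiction (sym eq) (proj₁ (ρ#P σ∈))
  functional′ (there σ∈)  (there τ∈)  eq = functional P σ∈ τ∈ eq

module _ (P : Program Name) (ρ : Rule Name) (ρ#P : head ρ #ₚ P) where

  private P⁺ = extend P ρ ρ#P

  -- The new rule fires only on terms headed by its name, which a fresh term is not; older bodies
  -- lack that name, so freshness persists.
  extend-⟶⁻ : ∀ {M N} → head ρ # M → P⁺ ⊢ M ⟶ N → P ⊢ M ⟶ N × head ρ # N
  extend-⟶⁻ ρ#M s with ⟶-inv s
  ... | σ , ts , here refl , refl , refl
    with name ρ≢ρ , _ ← #-·*⁻ ts ρ#M = contradiction refl ρ≢ρ
  ... | σ , ts , there σ∈ , refl , refl =
    step σ∈ ts , #-[] (proj₂ (ρ#P σ∈)) (proj₂ (#-·*⁻ ts ρ#M))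

  extend-↠⁻ : ∀ {M N} → head ρ # M → P⁺ ⊢ M ↠ N → P ⊢ M ↠ N × head ρ # N
  extend-↠⁻ ρ#M ε        = ε , ρ#M
  extend-↠⁻ ρ#M (s ◅ ss)
    with s′ , ρ#N ← extend-⟶⁻ ρ#M s
    with ss′ , ρ#V ← extend-↠⁻ ρ#N ss = s′ ◅ ss′ , ρ#V

  ↠-extend : ∀ {M N} → P ⊢ M ↠ N → P⁺ ⊢ M ↠ N
  ↠-extend = ↠-mono {P = P} {P⁺} there

  extend-conservative : ∀ {M} → head ρ # M →
                        Terminating P M ⇔ Terminating P⁺ M
  extend-conservative {M} ρ#M = mk⇔ forward backward
    where
    forward : Terminating P M → Terminating P⁺ M
    -- `V` still avoids the new name, so a step from it in `P⁺` would already be one in `P`.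
    forward (V , red , fin) = V , red⁺ , λ (W , s) →
      fin (W , proj₁ (extend-⟶⁻ (proj₂ (extend-↠⁻ ρ#M red⁺)) s))
      where red⁺ = ↠-extend red

    backward : Terminating P⁺ M → Terminating P M
    backward (V , red , fin) = V , proj₁ (extend-↠⁻ ρ#M red) , λ (W , s) →
      fin (W , ⟶-mono {P = P} {P⁺} there s)

-- Consequences of observational equivalence.

≈-refl : ∀ {P : Program Name} {M} → P ⊢ M ≈ M
≈-refl P′ P⊆P′ X = ⇔-id _

≈-sym : ∀ {P : Program Name} {M N} → P ⊢ M ≈ N → P ⊢ N ≈ M
≈-sym M≈N P′ P⊆P′ X = ⇔-sym (M≈N P′ P⊆P′ X)

conjugate : ∀ {A A′ B B′ : Set} → A ⇔ A′ → B ⇔ B′ → A ⇔ B → A′ ⇔ B′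
conjugate f g h = g ⇔-∘ (h ⇔-∘ ⇔-sym f)

module _ (inf : Infinite Name) where

  -- `≈` observes a term only in argument position. A rule for a fresh `f` moves it to the head, and
  -- since the reduct avoids `f`, termination is the same without the new rule.
  ≈-apply : ∀ {P P′ : Program Name} {M N} → P ⊢ M ≈ N → rules P ⊆ rules P′ →
            ∀ e c → Terminating P′ (M · e · c) ⇔ Terminating P′ (N · e · c)
  ≈-apply {P} {P′} {M} {N} M≈N P⊆P′ e c
    with f , f#P′ , f#M ∷ f#N ∷ f#e ∷ f#c ∷ [] ←
           fresh inf P′ (M ∷ N ∷ e ∷ c ∷ []) =
    conjugate (observe f#M) (observe f#N)
      (M≈N P⁺ (there ∘ P⊆P′) (name f · e · c))
    where
    ρ : Rule Name
    ρ = rule f 3 (λ e c M → M · e · c)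

    P⁺ = extend P′ ρ f#P′

    observe : ∀ {M} → f # M →
              Terminating P⁺ (name f · e · c · M) ⇔ Terminating P′ (M · e · c)
    observe {M} f#M =
      ⇔-sym (extend-conservative P′ ρ f#P′ (f#M · f#e · f#c)) ⇔-∘
      ↠-Terminating (step (here refl) (e ∷ c ∷ M ∷ []) ◅ ε)

  -- One name plays both roles: alone it is final because its only rule takes two arguments, and
  -- with two arguments it steps to itself.
  divergent-extension : (P : Program Name) →
    ∃ λ P′ → rules P ⊆ rules P′ ×
      ∃ λ f → Terminating P′ f × (∀ x y → ¬ Terminating P′ (f · x · y))
  divergent-extension P with f , f#P , [] ← fresh inf P [] =
    P⁺ , there , name f , (name f , ε , final) ,
    λ x y → loop-diverges (step (here refl) (x ∷ y ∷ []))
    where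
    P⁺ = extend P (rule f 2 (λ x y → name f · x · y)) f#P

    final : Final P⁺ (name f)
    final (N , s) with ⟶-inv s
    ... | σ , x ∷ y ∷ [] , here refl , () , _
    ... | σ , ts , there σ∈ , eq , _ =
      proj₁ (f#P σ∈) (trans (cong headOf eq) (headOf-·* _ ts))

  zero≉suc : ∀ {P : Program Name} {M N x} →
             (∀ z s → P ⊢ M · z · s ↠ z) → (∀ z s → P ⊢ N · z · s ↠ s · x) →
             ¬ P ⊢ M ≈ N
  zero≉suc {P} M-zero N-suc M≈N
    -- `s` receives just one argument, hence `f · f`: the successor reaches the looping `f · f · x`,
    -- while zero returns the final `f`.
    with P′ , P⊆P′ , f , f↓ , f↑ ← divergent-extension P =
    f↑ f _ (to (conjugate
      (↠-Terminating (↠-mono {P = P} {P′} P⊆P′ (M-zero f (f · f))))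
      (↠-Terminating (↠-mono {P = P} {P′} P⊆P′ (N-suc f (f · f))))
      (≈-apply {P = P} {P′} M≈N P⊆P′ f (f · f))) f↓)

  nil≉cons : ∀ {P : Program Name} {M N x xs} →
             (∀ e c → P ⊢ M · e · c ↠ e) →
             (∀ e c → P ⊢ N · e · c ↠ c · x · xs) → ¬ P ⊢ M ≈ N
  nil≉cons {P} M-nil N-cons M≈N
    with P′ , P⊆P′ , f , f↓ , f↑ ← divergent-extension P =
    f↑ _ _ (to (conjugate
      (↠-Terminating (↠-mono {P = P} {P′} P⊆P′ (M-nil f f)))
      (↠-Terminating (↠-mono {P = P} {P′} P⊆P′ (N-cons f f)))
      (≈-apply {P = P} {P′} M≈N P⊆P′ f f)) f↓)

  -- The continuation `name f · X` receives both components and applies `X` to the chosen one, so an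
  -- observation of a component becomes one of the whole cell.
  cons-≈-component : ∀ {P : Program Name} {M N x xs y ys} →
    (∀ e c → P ⊢ M · e · c ↠ c · x · xs) →
    (∀ e c → P ⊢ N · e · c ↠ c · y · ys) →
    P ⊢ M ≈ N → (i : Fin 2) →
    P ⊢ lookup (x ∷ xs ∷ []) i ≈ lookup (y ∷ ys ∷ []) i
  cons-≈-component {P} {M} {N} {x} {xs} {y} {ys} M-cons N-cons M≈N i P′ P⊆P′ X
    with f , f#P′ , f#X ∷ f#x ∷ f#xs ∷ f#y ∷ f#ys ∷ [] ←
           fresh inf P′ (X ∷ x ∷ xs ∷ y ∷ ys ∷ []) =
    conjugate (select M-cons f#x f#xs) (select N-cons f#y f#ys)
      (≈-apply {P = P} {P⁺} M≈N (there ∘ P⊆P′) X (name f · X))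
    where
    ρ : Rule Name
    -- Variable 0 stands for `X`, so component `i` is variable `suc i`; substitution then computes
    -- to a `lookup` at `i` without a case split.
    ρ = record { head = f ; arity = 3 ; body = var zero · var (suc i) }

    P⁺ = extend P′ ρ f#P′

    select : ∀ {M x xs} → (∀ e c → P ⊢ M · e · c ↠ c · x · xs) →
             f # x → f # xs →
             Terminating P⁺ (M · X · (name f · X)) ⇔
             Terminating P′ (X · lookup (x ∷ xs ∷ []) i)
    select {M} {x} {xs} M-cons f#x f#xs =
      ⇔-sym (extend-conservative P′ ρ f#P′ (f#X · f#component i)) ⇔-∘
      ↠-Terminating
        (↠-mono {P = P} {P⁺} (there ∘ P⊆P′) (M-cons X (name f · X)) ◅◅
         step (here refl) (X ∷ x ∷ xs ∷ []) ◅ ε)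
      where
      f#component : ∀ i → f # lookup (x ∷ xs ∷ []) i
      f#component zero       = f#x
      f#component (suc zero) = f#xs

-- Correctness of the list product.

module _ (inf : Infinite Name) (c : Names Name) (P : Program Name)
         (R⊆P : listMultRules c ⊆ rules P) where

  open Names c using (A; B; C; PostMult)

  Zero-↠ : ∀ z s → P ⊢ name (Zero c) · z · s ↠ z
  Zero-↠ z s = step (R⊆P (here refl)) (z ∷ s ∷ []) ◅ ε

  S-↠ : ∀ x z s → P ⊢ name (S c) · x · z · s ↠ s · x
  S-↠ x z s = step (R⊆P (there (here refl))) (x ∷ z ∷ s ∷ []) ◅ ε

  Nil-↠ : ∀ e k → P ⊢ name (Nil c) · e · k ↠ e
  Nil-↠ e k = step (R⊆P (there (there (here refl)))) (e ∷ k ∷ []) ◅ ε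

  Cons-↠ : ∀ x xs e k → P ⊢ name (Cons c) · x · xs · e · k ↠ k · x · xs
  Cons-↠ x xs e k =
    step (R⊆P (there (there (there (here refl))))) (x ∷ xs ∷ e ∷ k ∷ []) ◅ ε

  ListMult-↠ : ∀ xs r → P ⊢ name (ListMult c) · xs · r ↠
                            name A · xs · r · (r · name (Zero c))
  ListMult-↠ xs r =
    step (R⊆P (there (there (there (there (here refl)))))) (xs ∷ r ∷ []) ◅ ε

  A-↠ : ∀ xs r abort → P ⊢ name A · xs · r · abort ↠
    xs · (r · (name (S c) · name (Zero c))) · (name B · r · abort)
  A-↠ xs r abort =
    step (R⊆P (there (there (there (there (there (here refl)))))))
      (xs ∷ r ∷ abort ∷ []) ◅ ε

  B-↠ : ∀ r abort x xs → P ⊢ name B · r · abort · x · xs ↠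
    x · abort · (name C · r · abort · x · xs)
  B-↠ r abort x xs =
    step (R⊆P (there (there (there (there (there (there (here refl))))))))
      (r ∷ abort ∷ x ∷ xs ∷ []) ◅ ε

  C-↠ : ∀ r abort x xs x′ → P ⊢ name C · r · abort · x · xs · x′ ↠
    name A · xs · (name PostMult · x · r) · abort
  C-↠ r abort x xs x′ =
    step (R⊆P (there (there (there (there (there (there (there (here refl)))))))))
      (r ∷ abort ∷ x ∷ xs ∷ x′ ∷ []) ◅ ε

  PostMult-↠ : ∀ x r y → P ⊢ name PostMult · x · r · y ↠
    name (Mult c) · x · y · r
  PostMult-↠ x r y =
    step (R⊆P (there (there (there (there (there (there (there (there
      (here refl)))))))))) (x ∷ r ∷ y ∷ []) ◅ ε

  Zero∈⟪0⟫ : name (Zero c) ∈ ⟪ 0 ⟫ℕ c P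
  Zero∈⟪0⟫ = zero-like Zero-↠ , ≈-refl {P = P}

  S·Zero∈⟪1⟫ : name (S c) · name (Zero c) ∈ ⟪ 1 ⟫ℕ c P
  S·Zero∈⟪1⟫ = suc-like (proj₁ Zero∈⟪0⟫) (S-↠ _) , ≈-refl {P = P}

  module _ (mult : (m p : ℕ) (r t u : 𝒰 Name) →
              t ∈ ⟪ m ⟫ℕ c P → u ∈ ⟪ p ⟫ℕ c P →
              ∃ λ v → v ∈ ⟪ m * p ⟫ℕ c P × P ⊢ name (Mult c) · t · u · r ↠ r · v)
    where

    -- A zero entry discards every pending multiplication, so the outcome is a disjunction. The
    -- induction changes `r` to `PostMult.x.r` for the tail and keeps `abort`.
    A-correct : (l : List ℕ) (r abort t : 𝒰 Name) → t ∈ ⟪ l ⟫List c P →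
      (product l ≡ 0 × P ⊢ name A · t · r · abort ↠ abort) ⊎
      (∃ λ u → u ∈ ⟪ product l ⟫ℕ c P × P ⊢ name A · t · r · abort ↠ r · u)
    A-correct [] r abort t (nil-like t-nil , t≈) =
      inj₂ (_ , S·Zero∈⟪1⟫ , A-↠ t r abort ◅◅ t-nil _ _)
    A-correct [] r abort t (cons-like _ _ t-cons , t≈) =
      contradiction (≈-sym {P = P} t≈) (nil≉cons inf Nil-↠ t-cons)
    A-correct (m ∷ l) r abort t (nil-like t-nil , t≈) =
      contradiction t≈ (nil≉cons inf t-nil (Cons-↠ _ _))
    A-correct (m ∷ l) r abort t (cons-like {x = x} {xs} x∈ xs∈ t-cons , t≈) =
      by-head m x∈ (component zero)
      where
      component : (i : Fin 2) → P ⊢ lookup (x ∷ xs ∷ []) i ≈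
                                    lookup (⟨ m ⟩ℕ c ∷ ⟨ l ⟩List c ∷ []) i
      component = cons-≈-component inf t-cons (Cons-↠ _ _) t≈

      to-head : P ⊢ name A · t · r · abort ↠
                    x · abort · (name C · r · abort · x · xs)
      to-head = A-↠ t r abort ◅◅ t-cons _ _ ◅◅ B-↠ r abort x xs

      by-head : ∀ m → ⟦ℕ⟧ P x → P ⊢ x ≈ ⟨ m ⟩ℕ c →
        (m * product l ≡ 0 × P ⊢ name A · t · r · abort ↠ abort) ⊎
        (∃ λ u → u ∈ ⟪ m * product l ⟫ℕ c P ×
                 P ⊢ name A · t · r · abort ↠ r · u)
      -- A zero entry selects `abort` before the tail is inspected.
      by-head zero (zero-like x-zero) x≈ =
        inj₁ (refl , to-head ◅◅ x-zero _ _)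
      by-head (suc m) (zero-like x-zero) x≈ =
        contradiction x≈ (zero≉suc inf x-zero (S-↠ _))
      -- `m` stays arbitrary: `mult` accepts any `m`, so a successor-like `x` is treated uniformly,
      -- without refuting `m = 0`.
      by-head m x∈@(suc-like _ x-suc) x≈
        with to-tail ← to-head ◅◅ x-suc _ _ ◅◅ C-↠ r abort x xs _
        with A-correct l (name PostMult · x · r) abort xs
               (xs∈ , component (suc zero))
      ... | inj₁ (l≡0 , red) =
        inj₁ (trans (cong (m *_) l≡0) (*-zeroʳ m) , to-tail ◅◅ red)
      -- The tail hands its product `u` to `PostMult.x.r`, which calls `Mult` on `x` and `u` with
      -- the original `r`.
      ... | inj₂ (u , u∈ , red)
        with v , v∈ , red′ ← mult m (product l) r x u (x∈ , x≈) u∈ =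
        inj₂ (v , v∈ , to-tail ◅◅ red ◅◅ PostMult-↠ x r u ◅◅ red′)

theorem36 : (Name : Set) → Infinite Name →
    (c : Names Name) (P : Program Name) → listMultRules c ⊆ rules P →
    ((m p : ℕ) (r t u : 𝒰 Name) → t ∈ ⟪ m ⟫ℕ c P → u ∈ ⟪ p ⟫ℕ c P →
    ∃ λ v → v ∈ ⟪ m * p ⟫ℕ c P × P ⊢ name (Mult c) · t · u · r ↠ r · v) →
    (l : List ℕ) (r t : 𝒰 Name) → t ∈ ⟪ l ⟫List c P →
    ∃ λ u → u ∈ ⟪ product l ⟫ℕ c P × P ⊢ name (ListMult c) · t · r ↠ r · u
theorem36 Name inf c P R⊆P mult l r t t∈
  with A-correct inf c P R⊆P mult l r (r · name (Zero c)) t t∈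
-- `ListMult` sets `abort` to `r.Zero`, so a jump to it delivers `Zero`, a representative of the
-- vanishing product.
... | inj₁ (l≡0 , red) =
  name (Zero c)
  , subst (λ n → name (Zero c) ∈ ⟪ n ⟫ℕ c P) (sym l≡0) (Zero∈⟪0⟫ inf c P R⊆P)
  , ListMult-↠ inf c P R⊆P t r ◅◅ red
... | inj₂ (u , u∈ , red) = u , u∈ , ListMult-↠ inf c P R⊆P t r ◅◅ red
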